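{- No deterministic online algorithm for the Proportional Online Unbounded Knapsack Problem with Removal can have a (strict) competitive ratio of less than $3/2$.
   Context: Problem. An instance of the Online Unbounded Knapsack Problem with Removal is a finite sequence of items $I=(x_1,\dots,x_n)$, where an item $x=(w,v)$ has a weight $w(x)=w\in(0,1]$ and a value $v(x)=v\in\mathbb{R}_{>0}$. A solution is a finite multiset $S$ of items from $I$ (each item may appear arbitrarily often) with $\sum_{x\in S}w(x)\le 1$; its gain is $v(S)=\sum_{x\in S}v(x)$. $\mathrm{Opt}(I)$ denotes a solution to $I$ of maximum gain. In the proportional variant, every item satisfies $w(x)=v(x)$, and an item $x$ is identified with this number, $x=w(x)=v(x)\in(0,1]$. Online algorithms. An online algorithm maintains a solution $S$ ("knapsack"), initially empty. Items arrive one by one in order; when an item $x$ arrives, the algorithm, knowing only the items received so far (in particular not knowing the number of items or any future item), may add any number of copies of $x$ to $S$ and then remove an arbitrary sub-multiset from $S$, such that $S$ is again a valid solution. $\mathrm{Alg}(I)$ denotes the solution held by the algorithm after all of $I$ has been processed. Competitive ratio. A deterministic algorithm Alg is (strictly) $c$-competitive, for a constant $c\ge 1$, if $c\cdot v(\mathrm{Alg}(I))\ge v(\mathrm{Opt}(I))$ for every instance $I$. Its (strict) competitive ratio is the infimum of all $c\ge1$ for which it is $c$-competitive (and $\infty$ if there is no such $c$). -}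

module Defs where

open import Algebra.Bundles.Raw using (RawMonoid)
import Algebra.Definitions.RawMonoid as RawMonoidDefinitions
open import Data.Nat.Base as ℕ using (ℕ; _⊔_)
import Data.Nat.Properties as ℕ
open import Data.Product.Base using (∃-syntax; _×_; _,_)
open import Data.Rational.Base as ℚ using (ℚ; 0ℚ; 1ℚ; ½; ∣_∣; 1/_)
import Data.Rational.Properties as ℚ
open import Data.Rational.Solver using (module +-*-Solver)
open import Data.Vec.Base using (Vec; []; _∷_; _∷ʳ_; init)
open import Data.Vec.Relation.Binary.Pointwise.Inductive using (Pointwise)
open import Level using (0ℓ)
open import Relation.Binary.Core using (Rel)
open import Relation.Binary.PropositionalEquality
  using (_≡_; refl; sym; trans; cong; cong₂; subst)
open import Relation.Nullary.Construct.Add.Supremum using (_⁺; [_])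
open import Relation.Nullary.Negation.Core using (¬_)
open import Relation.Unary using (Pred)

------------------------------------------------------------------------
-- Real numbers, as Cauchy sequences of rationals up to _≈_

IsCauchy : Pred (ℕ → ℚ) 0ℓ
IsCauchy u = ∀ ε → 0ℚ ℚ.< ε →
  ∃[ N ] (∀ m n → N ℕ.≤ m → N ℕ.≤ n → ∣ u m ℚ.- u n ∣ ℚ.< ε)

record ℝ : Set where
  constructor mkℝ
  field
    seq    : ℕ → ℚ
    cauchy : IsCauchy seq

open ℝ public

private
  open +-*-Solver using (solve; _:+_; _:*_; _:-_; con; _:=_)

  half>0 : ∀ {ε} → 0ℚ ℚ.< ε → 0ℚ ℚ.< ½ ℚ.* ε
  half>0 ε>0 = ℚ.*-monoʳ-<-pos ½ ε>0

  half+half : ∀ ε → ½ ℚ.* ε ℚ.+ ½ ℚ.* ε ≡ ε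
  half+half = solve 1 (λ e → con ½ :* e :+ con ½ :* e := e) refl

  cauchy-const : ∀ q → IsCauchy (λ _ → q)
  cauchy-const q ε ε>0 = 0 , λ _ _ _ _ →
    subst (λ z → ∣ z ∣ ℚ.< ε) (sym (ℚ.+-inverseʳ q)) ε>0

  cauchy-+ : ∀ u v → IsCauchy u → IsCauchy v → IsCauchy (λ n → u n ℚ.+ v n)
  cauchy-+ u v cu cv ε ε>0
    with M , hM ← cu (½ ℚ.* ε) (half>0 ε>0)
       | N , hN ← cv (½ ℚ.* ε) (half>0 ε>0)
    = M ⊔ N , λ m n m≥ n≥ → begin-strict
      ∣ (u m ℚ.+ v m) ℚ.- (u n ℚ.+ v n) ∣
        ≡⟨ cong ∣_∣ (solve 4 (λ a b c d → (a :+ b) :- (c :+ d) := (a :- c) :+ (b :- d))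
             refl (u m) (v m) (u n) (v n)) ⟩
      ∣ (u m ℚ.- u n) ℚ.+ (v m ℚ.- v n) ∣
        ≤⟨ ℚ.∣p+q∣≤∣p∣+∣q∣ (u m ℚ.- u n) (v m ℚ.- v n) ⟩
      ∣ u m ℚ.- u n ∣ ℚ.+ ∣ v m ℚ.- v n ∣
        <⟨ ℚ.+-mono-< (hM m n (ℕ.m⊔n≤o⇒m≤o M N m≥) (ℕ.m⊔n≤o⇒m≤o M N n≥))
                      (hN m n (ℕ.m⊔n≤o⇒n≤o M N m≥) (ℕ.m⊔n≤o⇒n≤o M N n≥)) ⟩
      ½ ℚ.* ε ℚ.+ ½ ℚ.* ε
        ≡⟨ half+half ε ⟩
      ε ∎
    where open ℚ.≤-Reasoning

  eventually-bounded : ∀ u → IsCauchy u →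
    ∃[ B ] ((0ℚ ℚ.< B) × ∃[ N ] (∀ n → N ℕ.≤ n → ∣ u n ∣ ℚ.≤ B))
  eventually-bounded u cu with N , hN ← cu 1ℚ (ℚ.positive⁻¹ 1ℚ)
    = 1ℚ ℚ.+ ∣ u N ∣
    , ℚ.+-mono-<-≤ (ℚ.positive⁻¹ 1ℚ) (ℚ.0≤∣p∣ (u N))
    , N , λ n n≥ → begin
      ∣ u n ∣
        ≡⟨ cong ∣_∣ (solve 2 (λ a b → a := (a :- b) :+ b) refl (u n) (u N)) ⟩
      ∣ (u n ℚ.- u N) ℚ.+ u N ∣
        ≤⟨ ℚ.∣p+q∣≤∣p∣+∣q∣ (u n ℚ.- u N) (u N) ⟩
      ∣ u n ℚ.- u N ∣ ℚ.+ ∣ u N ∣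
        ≤⟨ ℚ.+-monoˡ-≤ ∣ u N ∣ (ℚ.<⇒≤ (hN n N n≥ ℕ.≤-refl)) ⟩
      1ℚ ℚ.+ ∣ u N ∣ ∎
    where open ℚ.≤-Reasoning

  quotient : ∀ {B δ} → 0ℚ ℚ.< B → 0ℚ ℚ.< δ → ∃[ η ] ((0ℚ ℚ.< η) × (B ℚ.* η ≡ δ))
  quotient {B} {δ} B>0 δ>0 =
    (1/ B) ℚ.* δ
    , subst (ℚ._< (1/ B) ℚ.* δ) (ℚ.*-zeroʳ (1/ B)) (ℚ.*-monoʳ-<-pos (1/ B) δ>0)
    , trans (sym (ℚ.*-assoc B (1/ B) δ))
        (trans (cong (ℚ._* δ) (ℚ.*-inverseʳ B)) (ℚ.*-identityˡ δ))
    where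
    instance
      B-pos = ℚ.positive B>0
      B-nz  = ℚ.pos⇒nonZero B
      B⁻¹   = ℚ.1/pos⇒pos B

  *-bound : ∀ a b {A η} → 0ℚ ℚ.< A → ∣ a ∣ ℚ.≤ A → ∣ b ∣ ℚ.< η → ∣ a ℚ.* b ∣ ℚ.< A ℚ.* η
  *-bound a b {A} {η} A>0 a≤ b< = begin-strict
    ∣ a ℚ.* b ∣         ≡⟨ ℚ.∣p*q∣≡∣p∣*∣q∣ a b ⟩
    ∣ a ∣ ℚ.* ∣ b ∣     ≤⟨ ℚ.*-monoʳ-≤-nonNeg ∣ b ∣ {{ℚ.nonNegative (ℚ.0≤∣p∣ b)}} a≤ ⟩
    A ℚ.* ∣ b ∣         <⟨ ℚ.*-monoʳ-<-pos A {{ℚ.positive A>0}} b< ⟩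
    A ℚ.* η             ∎
    where open ℚ.≤-Reasoning

  *-difference : ∀ a b c d →
    a ℚ.* b ℚ.- c ℚ.* d ≡ a ℚ.* (b ℚ.- d) ℚ.+ d ℚ.* (a ℚ.- c)
  *-difference = solve 4 (λ a b c d →
    a :* b :- c :* d := a :* (b :- d) :+ d :* (a :- c)) refl

  *-close : ∀ a b c d {A B η θ} → 0ℚ ℚ.< A → 0ℚ ℚ.< B → ∣ a ∣ ℚ.≤ A → ∣ d ∣ ℚ.≤ B →
    ∣ a ℚ.- c ∣ ℚ.< θ → ∣ b ℚ.- d ∣ ℚ.< η →
    ∣ a ℚ.* b ℚ.- c ℚ.* d ∣ ℚ.< A ℚ.* η ℚ.+ B ℚ.* θ
  *-close a b c d {A} {B} {η} {θ} A>0 B>0 a≤ d≤ a-c< b-d< = begin-strict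
    ∣ a ℚ.* b ℚ.- c ℚ.* d ∣
      ≡⟨ cong ∣_∣ (*-difference a b c d) ⟩
    ∣ a ℚ.* (b ℚ.- d) ℚ.+ d ℚ.* (a ℚ.- c) ∣
      ≤⟨ ℚ.∣p+q∣≤∣p∣+∣q∣ (a ℚ.* (b ℚ.- d)) (d ℚ.* (a ℚ.- c)) ⟩
    ∣ a ℚ.* (b ℚ.- d) ∣ ℚ.+ ∣ d ℚ.* (a ℚ.- c) ∣
      <⟨ ℚ.+-mono-< (*-bound a (b ℚ.- d) A>0 a≤ b-d<) (*-bound d (a ℚ.- c) B>0 d≤ a-c<) ⟩
    A ℚ.* η ℚ.+ B ℚ.* θ ∎
    where open ℚ.≤-Reasoning

  cauchy-* : ∀ u v → IsCauchy u → IsCauchy v → IsCauchy (λ n → u n ℚ.* v n)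
  cauchy-* u v cu cv ε ε>0 =
    let A , A>0 , K , hA = eventually-bounded u cu
        B , B>0 , L , hB = eventually-bounded v cv
        η , η>0 , Aη     = quotient A>0 (half>0 ε>0)
        θ , θ>0 , Bθ     = quotient B>0 (half>0 ε>0)
        M , hM           = cu θ θ>0
        N , hN           = cv η η>0
    in  (K ⊔ L) ⊔ (M ⊔ N) , λ m n m≥ n≥ →
      let m≥MN = ℕ.m⊔n≤o⇒n≤o (K ⊔ L) (M ⊔ N) m≥
          n≥MN = ℕ.m⊔n≤o⇒n≤o (K ⊔ L) (M ⊔ N) n≥
          m≥K  = ℕ.m⊔n≤o⇒m≤o K L (ℕ.m⊔n≤o⇒m≤o (K ⊔ L) (M ⊔ N) m≥)
          n≥L  = ℕ.m⊔n≤o⇒n≤o K L (ℕ.m⊔n≤o⇒m≤o (K ⊔ L) (M ⊔ N) n≥)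
      in  subst (∣ u m ℚ.* v m ℚ.- u n ℚ.* v n ∣ ℚ.<_)
            (trans (cong₂ ℚ._+_ Aη Bθ) (half+half ε))
            (*-close (u m) (v m) (u n) (v n) A>0 B>0 (hA m m≥K) (hB n n≥L)
              (hM m n (ℕ.m⊔n≤o⇒m≤o M N m≥MN) (ℕ.m⊔n≤o⇒m≤o M N n≥MN))
              (hN m n (ℕ.m⊔n≤o⇒n≤o M N m≥MN) (ℕ.m⊔n≤o⇒n≤o M N n≥MN)))

fromℚ : ℚ → ℝ
fromℚ q = mkℝ (λ _ → q) (cauchy-const q)

0ℝ 1ℝ : ℝ
0ℝ = fromℚ 0ℚ
1ℝ = fromℚ 1ℚ

infixl 6 _+_
infixl 7 _*_
infix  4 _<_ _≤_ _≈_

_+_ _*_ : ℝ → ℝ → ℝ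
x + y = mkℝ (λ n → seq x n ℚ.+ seq y n) (cauchy-+ (seq x) (seq y) (cauchy x) (cauchy y))
x * y = mkℝ (λ n → seq x n ℚ.* seq y n) (cauchy-* (seq x) (seq y) (cauchy x) (cauchy y))

_<_ _≤_ _≈_ : Rel ℝ 0ℓ
x < y = ∃[ ε ] ((0ℚ ℚ.< ε) × ∃[ N ] (∀ n → N ℕ.≤ n → seq x n ℚ.+ ε ℚ.≤ seq y n))
x ≤ y = ¬ (y < x)
x ≈ y = (x ≤ y) × (y ≤ x)

-- ⊤⁺ plays the role of ∞.
open import Relation.Binary.Construct.Add.Supremum.Strict _<_ public
  using (_<⁺_)
open import Relation.Binary.Construct.Add.Supremum.NonStrict _≤_ public
  using (_≤⁺_)

-- Taken in the extended order, so the infimum of the empty set is ∞.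
record IsInfimum (P : Pred ℝ 0ℓ) (ρ : ℝ ⁺) : Set where
  field
    lowerBound : ∀ c → P c → ρ ≤⁺ [ c ]
    greatest   : ∀ σ → (∀ c → P c → σ ≤⁺ [ c ]) → σ ≤⁺ ρ

+-0-rawMonoid : RawMonoid 0ℓ 0ℓ
+-0-rawMonoid = record { Carrier = ℝ ; _≈_ = _≈_ ; _∙_ = _+_ ; ε = 0ℝ }

open RawMonoidDefinitions +-0-rawMonoid public
  using () renaming (_×_ to _·_)

------------------------------------------------------------------------
-- The proportional unbounded knapsack problem

-- size is both the weight and the value of the item.
record Item : Set where
  constructor mkItem
  field
    size   : ℝ
    size>0 : 0ℝ < size
    size≤1 : size ≤ 1ℝ

open Item public

Instance : ℕ → Set
Instance = Vec Item

-- A multiset of items from an instance: the number of copies of each item.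
Multiset : ℕ → Set
Multiset = Vec ℕ

-- The total size is at once the weight and the gain of a multiset.
total : ∀ {n} → Instance n → Multiset n → ℝ
total []       []       = 0ℝ
total (x ∷ xs) (k ∷ ks) = k · size x + total xs ks

weight gain : ∀ {n} → Instance n → Multiset n → ℝ
weight = total
gain   = total

IsSolution : ∀ {n} → Instance n → Pred (Multiset n) 0ℓ
IsSolution I S = weight I S ≤ 1ℝ

record IsOptimal {n} (I : Instance n) (S : Multiset n) : Set where
  field
    solution : IsSolution I S
    maximal  : ∀ T → IsSolution I T → gain I T ≤ gain I S

------------------------------------------------------------------------
-- Deterministic online algorithms with removal

-- knapsack I is the content of the knapsack once exactly the items of I have
-- arrived, in this order; it is a function of those items alone.  By step, on
-- the arrival of x the copies of earlier items can only be removed, while the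
-- number of copies of x itself is unconstrained.  By respects, the algorithm
-- sees items as real numbers and not as their representing sequences.
record OnlineAlgorithm : Set where
  field
    knapsack : ∀ {n} → Instance n → Multiset n
    valid    : ∀ {n} (I : Instance n) → IsSolution I (knapsack I)
    step     : ∀ {n} (I : Instance n) (x : Item) →
               Pointwise ℕ._≤_ (init (knapsack (I ∷ʳ x))) (knapsack I)
    respects : ∀ {n} {I J : Instance n} →
               Pointwise (λ x y → size x ≈ size y) I J → knapsack I ≡ knapsack J

open OnlineAlgorithm public

IsCompetitive : OnlineAlgorithm → Pred ℝ 0ℓ
IsCompetitive A c = ∀ {n} (I : Instance n) (Opt : Multiset n) → IsOptimal I Opt →
  gain I Opt ≤ c * gain I (knapsack A I)

IsCompetitiveRatio : OnlineAlgorithm → Pred (ℝ ⁺) 0ℓ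
IsCompetitiveRatio A = IsInfimum (λ c → (1ℝ ≤ c) × IsCompetitive A c)

{-# OPTIONS --safe #-}
-- For small ε, offer b = 2/3 − ε and then c = 1/3 + 2ε, which do not fit
-- together.  If the algorithm keeps b, it holds no c, and d = 2/3 − 2ε is
-- offered: c + d fills the knapsack, while the algorithm packs at most one of
-- b and d.  If it drops b, then e = 1/3 + ε is offered: b + e fills the
-- knapsack, while the algorithm packs at most two items of size at most c.
-- Either way its gain is at most 2c = 2/3 + 4ε, against an optimum of 1.
module Submission where

open import Defs
open import Algebra.Properties.Monoid.Mult using (×-homo-+)
open import Data.Integer.Base using (+_)
open import Data.Nat.Base as ℕ using (ℕ; zero; suc; z≤n)
import Data.Nat.Properties as ℕ
open import Data.Product.Base using (_×_; _,_; proj₁; proj₂)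
open import Data.Rational.Base as ℚ using (ℚ; 0ℚ; 1ℚ; _/_; NonNegative)
import Data.Rational.Properties as ℚ
open import Data.Rational.Solver using (module +-*-Solver)
open import Data.Sum.Base using (_⊎_; inj₁; inj₂)
open import Data.Vec.Base using ([]; _∷_; _∷ʳ_; init; sum)
open import Data.Vec.Relation.Binary.Pointwise.Inductive using (Pointwise; []; _∷_)
open import Relation.Binary.PropositionalEquality
  using (_≡_; refl; sym; cong; subst)
import Relation.Binary.Construct.Add.Supremum.NonStrict _≤_ as ≤⁺
import Relation.Binary.Construct.Add.Supremum.Strict _<_ as <⁺
open import Relation.Nullary.Construct.Add.Supremum using (_⁺; [_])
open import Relation.Nullary.Negation.Core using (¬_; contradiction)

open +-*-Solver using (solve; con; _:+_; _:*_; _:-_; _:=_)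
open import Algebra.Definitions.RawMonoid ℚ.+-0-rawMonoid using () renaming (_×_ to _×ℚ_)

-- Inequalities and natural multiples in ℚ.

≤-fromSlack : ∀ {p q} r → 0ℚ ℚ.≤ r → p ℚ.+ r ≡ q → p ℚ.≤ q
≤-fromSlack {p} r 0≤r refl =
  subst (ℚ._≤ p ℚ.+ r) (ℚ.+-identityʳ p) (ℚ.+-monoʳ-≤ p 0≤r)

p<p+q : ∀ p {q} → 0ℚ ℚ.< q → p ℚ.< p ℚ.+ q
p<p+q p {q} 0<q = subst (ℚ._< p ℚ.+ q) (ℚ.+-identityʳ p) (ℚ.+-monoʳ-< p 0<q)

×-monoʳ-≤ : ∀ n {p q} → p ℚ.≤ q → n ×ℚ p ℚ.≤ n ×ℚ q
×-monoʳ-≤ zero    p≤q = ℚ.≤-refl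
×-monoʳ-≤ (suc n) p≤q = ℚ.+-mono-≤ p≤q (×-monoʳ-≤ n p≤q)

0≤n×p : ∀ n {p} → 0ℚ ℚ.≤ p → 0ℚ ℚ.≤ n ×ℚ p
0≤n×p zero    0≤p = ℚ.≤-refl
0≤n×p (suc n) 0≤p = ℚ.+-mono-≤ 0≤p (0≤n×p n 0≤p)

×-monoˡ-≤ : ∀ {m n p} → 0ℚ ℚ.≤ p → m ℕ.≤ n → m ×ℚ p ℚ.≤ n ×ℚ p
×-monoˡ-≤ {n = n} 0≤p z≤n = 0≤n×p n 0≤p
×-monoˡ-≤ {p = p} 0≤p (ℕ.s≤s m≤n) = ℚ.+-monoʳ-≤ p (×-monoˡ-≤ 0≤p m≤n)

0≤p*q : ∀ p {q} .{{_ : NonNegative p}} → 0ℚ ℚ.≤ q → 0ℚ ℚ.≤ p ℚ.* q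
0≤p*q p {q} 0≤q = subst (ℚ._≤ p ℚ.* q) (ℚ.*-zeroʳ p) (ℚ.*-monoˡ-≤-nonNeg p 0≤q)

-- Bounds on totals, term by term along the representing sequences.

seq-· : ∀ k x i → seq (k · x) i ≡ k ×ℚ seq x i
seq-· zero    x i = refl
seq-· (suc k) x i = cong (seq x i ℚ.+_) (seq-· k x i)

≤-fromSeq : ∀ x y → (∀ i → seq x i ℚ.≤ seq y i) → x ≤ y
≤-fromSeq x y x≤y (δ , 0<δ , N , y<x) =
  ℚ.<-irrefl refl (ℚ.<-≤-trans (p<p+q _ 0<δ) (ℚ.≤-trans (y<x N ℕ.≤-refl) (x≤y N)))

-- Bounding every term, which constant sequences allow, turns comparisons of reals into comparisons
-- in ℚ.
SizeWithin : ℚ → ℚ → Item → Set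
SizeWithin m M x = ∀ i → (m ℚ.≤ seq (size x) i) × (seq (size x) i ℚ.≤ M)

-- Items without a copy are exempt, so the range only has to cover what is still packed.
PackedWithin : ∀ {n} → ℚ → ℚ → Instance n → Multiset n → Set
PackedWithin m M = Pointwise (λ x k → (k ≡ 0) ⊎ SizeWithin m M x)

total-lower : ∀ {n m M} {I : Instance n} {S} → PackedWithin m M I S →
  ∀ i → sum S ×ℚ m ℚ.≤ seq (total I S) i
total-lower [] i = ℚ.≤-refl
total-lower {m = m} {I = x ∷ I} {k ∷ S} (px ∷ p) i = begin
  (k ℕ.+ sum S) ×ℚ m                     ≡⟨ ×-homo-+ ℚ.+-0-monoid m k (sum S) ⟩
  k ×ℚ m ℚ.+ sum S ×ℚ m                  ≤⟨ ℚ.+-mono-≤ (head px) (total-lower p i) ⟩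
  k ×ℚ seq (size x) i ℚ.+ seq (total I S) i
    ≡⟨ cong (ℚ._+ _) (seq-· k (size x) i) ⟨
  seq (k · size x) i ℚ.+ seq (total I S) i ∎
  where
  open ℚ.≤-Reasoning
  head : (k ≡ 0) ⊎ SizeWithin m _ x → k ×ℚ m ℚ.≤ k ×ℚ seq (size x) i
  head (inj₁ refl) = ℚ.≤-refl
  head (inj₂ w)    = ×-monoʳ-≤ k (proj₁ (w i))

total-upper : ∀ {n m M} {I : Instance n} {S} → PackedWithin m M I S →
  ∀ i → seq (total I S) i ℚ.≤ sum S ×ℚ M
total-upper [] i = ℚ.≤-refl
total-upper {M = M} {x ∷ I} {k ∷ S} (px ∷ p) i = begin
  seq (k · size x) i ℚ.+ seq (total I S) i
    ≡⟨ cong (ℚ._+ _) (seq-· k (size x) i) ⟩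
  k ×ℚ seq (size x) i ℚ.+ seq (total I S) i ≤⟨ ℚ.+-mono-≤ (head px) (total-upper p i) ⟩
  k ×ℚ M ℚ.+ sum S ×ℚ M                     ≡⟨ ×-homo-+ ℚ.+-0-monoid M k (sum S) ⟨
  (k ℕ.+ sum S) ×ℚ M ∎
  where
  open ℚ.≤-Reasoning
  head : (k ≡ 0) ⊎ SizeWithin _ M x → k ×ℚ seq (size x) i ℚ.≤ k ×ℚ M
  head (inj₁ refl) = ℚ.≤-refl
  head (inj₂ w)    = ×-monoʳ-≤ k (proj₂ (w i))

fromℚ-< : ∀ {δ} q x → 0ℚ ℚ.< δ → (∀ i → q ℚ.+ δ ℚ.≤ seq x i) → fromℚ q < x
fromℚ-< q x 0<δ q+δ≤x = _ , 0<δ , 0 , λ i _ → q+δ≤x i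

-- Any `suc j` items of size at least `m` overflow the knapsack; the margin `δ` makes the overflow a
-- strict inequality of reals.
solution-count : ∀ {n m M δ} j (I : Instance n) S → PackedWithin m M I S →
  0ℚ ℚ.≤ m → 0ℚ ℚ.< δ → 1ℚ ℚ.+ δ ℚ.≤ suc j ×ℚ m → IsSolution I S → sum S ℕ.≤ j
solution-count j I S within 0≤m 0<δ 1<m S≤1 = ℕ.≮⇒≥ λ j<sum →
  S≤1 (fromℚ-< 1ℚ (total I S) 0<δ λ i → ℚ.≤-trans 1<m
    (ℚ.≤-trans (×-monoˡ-≤ 0≤m j<sum) (total-lower within i)))

-- Gain equals weight, so the gap by which some `T` beats a full knapsack is also a gap by which `T`
-- is overweight.
optimal-full : ∀ {n} {I : Instance n} {S} → (∀ i → seq (total I S) i ≡ 1ℚ) → IsOptimal I S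
optimal-full {I = I} {S} full = record
  { solution = ≤-fromSeq (total I S) 1ℝ λ i → ℚ.≤-reflexive (full i)
  ; maximal  = λ T T≤1 (δ , 0<δ , N , S<T) → T≤1
      (δ , 0<δ , N , λ i i≥ → subst (λ z → z ℚ.+ δ ℚ.≤ _) (full i) (S<T i i≥))
  }

-- The adversary for a fixed small ε.

module Adversary
  (ε : ℚ) (0<ε : 0ℚ ℚ.< ε) (ε≤1/24 : ε ℚ.≤ + 1 / 24)
  where

  slack : ℚ
  slack = + 1 / 24 ℚ.- ε

  0≤ε : 0ℚ ℚ.≤ ε
  0≤ε = ℚ.<⇒≤ 0<ε

  -- The linear inequalities in ε used here are certified by writing q − p as
  -- k (1/24 − ε) + l ε with k, l ≥ 0.
  ≤-byCombination : ∀ {p q} k l .{{_ : NonNegative k}} .{{_ : NonNegative l}} →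
    p ℚ.+ (k ℚ.* slack ℚ.+ l ℚ.* ε) ≡ q → p ℚ.≤ q
  ≤-byCombination k l = ≤-fromSlack _ (ℚ.+-mono-≤ (0≤p*q k 0≤slack) (0≤p*q l 0≤ε))
    where
    0≤slack : 0ℚ ℚ.≤ slack
    0≤slack = subst (ℚ._≤ slack) (ℚ.+-inverseʳ ε) (ℚ.+-monoˡ-≤ (ℚ.- ε) ε≤1/24)

  b c d e gainBound : ℚ
  b = + 2 / 3 ℚ.- ε
  c = + 1 / 3 ℚ.+ (ε ℚ.+ ε)
  d = + 2 / 3 ℚ.- (ε ℚ.+ ε)
  e = + 1 / 3 ℚ.+ ε
  gainBound = c ℚ.+ c

  open +-*-Solver using (Polynomial)

  -- Copies of the rationals above as polynomials in ε, from which the ring solver checks the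
  -- certificates.
  :slack :b :c :d :e :bound : Polynomial 1 → Polynomial 1
  :slack x = con (+ 1 / 24) :- x
  :b x = con (+ 2 / 3) :- x
  :c x = con (+ 1 / 3) :+ (x :+ x)
  :d x = con (+ 2 / 3) :- (x :+ x)
  :e x = con (+ 1 / 3) :+ x
  :bound x = :c x :+ :c x

  :combination : ℚ → ℚ → Polynomial 1 → Polynomial 1
  :combination k l x = con k :* :slack x :+ con l :* x

  constantItem : ∀ q → ε ℚ.≤ q → q ℚ.≤ 1ℚ → Item
  constantItem q ε≤q q≤1 = mkItem (fromℚ q)
    -- The gap witnessing positivity is ε itself, hence the lower bound ε on `q`.
    (fromℚ-< 0ℚ (fromℚ q) 0<ε λ _ → subst (ℚ._≤ q) (sym (ℚ.+-identityˡ ε)) ε≤q)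
    (≤-fromSeq (fromℚ q) 1ℝ λ _ → q≤1)

  itemB itemC itemD itemE : Item
  itemB = constantItem b
    (≤-byCombination (+ 16 / 1) (+ 14 / 1)
      (solve 1 (λ x → x :+ :combination (+ 16 / 1) (+ 14 / 1) x := :b x) refl ε))
    (≤-byCombination (+ 8 / 1) (+ 9 / 1)
      (solve 1 (λ x → :b x :+ :combination (+ 8 / 1) (+ 9 / 1) x := con 1ℚ) refl ε))
  itemC = constantItem c
    (≤-byCombination (+ 8 / 1) (+ 9 / 1)
      (solve 1 (λ x → x :+ :combination (+ 8 / 1) (+ 9 / 1) x := :c x) refl ε))
    (≤-byCombination (+ 16 / 1) (+ 14 / 1)
      (solve 1 (λ x → :c x :+ :combination (+ 16 / 1) (+ 14 / 1) x := con 1ℚ) refl ε))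
  itemD = constantItem d
    (≤-byCombination (+ 16 / 1) (+ 13 / 1)
      (solve 1 (λ x → x :+ :combination (+ 16 / 1) (+ 13 / 1) x := :d x) refl ε))
    (≤-byCombination (+ 8 / 1) (+ 10 / 1)
      (solve 1 (λ x → :d x :+ :combination (+ 8 / 1) (+ 10 / 1) x := con 1ℚ) refl ε))
  itemE = constantItem e
    (≤-byCombination (+ 8 / 1) (+ 8 / 1)
      (solve 1 (λ x → x :+ :combination (+ 8 / 1) (+ 8 / 1) x := :e x) refl ε))
    (≤-byCombination (+ 16 / 1) (+ 15 / 1)
      (solve 1 (λ x → :e x :+ :combination (+ 16 / 1) (+ 15 / 1) x := con 1ℚ) refl ε))

  d≤b : d ℚ.≤ b
  d≤b = ≤-byCombination (+ 0 / 1) (+ 1 / 1)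
    (solve 1 (λ x → :d x :+ :combination (+ 0 / 1) (+ 1 / 1) x := :b x) refl ε)

  e≤c : e ℚ.≤ c
  e≤c = ≤-byCombination (+ 0 / 1) (+ 1 / 1)
    (solve 1 (λ x → :e x :+ :combination (+ 0 / 1) (+ 1 / 1) x := :c x) refl ε)

  0≤d : 0ℚ ℚ.≤ d
  0≤d = ≤-byCombination (+ 16 / 1) (+ 14 / 1)
    (solve 1 (λ x → con 0ℚ :+ :combination (+ 16 / 1) (+ 14 / 1) x := :d x) refl ε)

  0≤e : 0ℚ ℚ.≤ e
  0≤e = ≤-byCombination (+ 8 / 1) (+ 9 / 1)
    (solve 1 (λ x → con 0ℚ :+ :combination (+ 8 / 1) (+ 9 / 1) x := :e x) refl ε)

  -- This is an equality; the right-hand side mirrors the recursion of `total`, with `0ℚ` for the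
  -- empty tail.
  b+c>1 : 1ℚ ℚ.+ ε ℚ.≤ 1 ×ℚ b ℚ.+ (1 ×ℚ c ℚ.+ 0ℚ)
  b+c>1 = ≤-byCombination (+ 0 / 1) (+ 0 / 1)
    (solve 1 (λ x → (con 1ℚ :+ x) :+ :combination (+ 0 / 1) (+ 0 / 1) x
        := (:b x :+ con 0ℚ) :+ ((:c x :+ con 0ℚ) :+ con 0ℚ)) refl ε)

  -- The slack is 1/3 - 5ε. Since d ≤ b, no two items of sizes b or d fit together.
  2d>1 : 1ℚ ℚ.+ ε ℚ.≤ 2 ×ℚ d
  2d>1 = ≤-byCombination (+ 8 / 1) (+ 3 / 1)
    (solve 1 (λ x → (con 1ℚ :+ x) :+ :combination (+ 8 / 1) (+ 3 / 1) x
        := :d x :+ (:d x :+ con 0ℚ)) refl ε)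

  3e>1 : 1ℚ ℚ.+ ε ℚ.≤ 3 ×ℚ e
  3e>1 = ≤-byCombination (+ 0 / 1) (+ 2 / 1)
    (solve 1 (λ x → (con 1ℚ :+ x) :+ :combination (+ 0 / 1) (+ 2 / 1) x
        := :e x :+ (:e x :+ (:e x :+ con 0ℚ))) refl ε)

  -- One item of size b or d obeys the same bound as two of size c or e, so both continuations share
  -- `gainBound`.
  1×b≤gainBound : 1 ×ℚ b ℚ.≤ gainBound
  1×b≤gainBound = ≤-byCombination (+ 0 / 1) (+ 5 / 1)
    (solve 1 (λ x → (:b x :+ con 0ℚ) :+ :combination (+ 0 / 1) (+ 5 / 1) x := :bound x) refl ε)

  2×c≤gainBound : 2 ×ℚ c ℚ.≤ gainBound
  2×c≤gainBound = ≤-byCombination (+ 0 / 1) (+ 0 / 1)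
    (solve 1 (λ x → (:c x :+ (:c x :+ con 0ℚ)) :+ :combination (+ 0 / 1) (+ 0 / 1) x
        := :bound x) refl ε)

  0≤3/2-24ε : 0ℚ ℚ.≤ + 3 / 2 ℚ.- + 24 / 1 ℚ.* ε
  0≤3/2-24ε = ≤-byCombination (+ 36 / 1) (+ 12 / 1)
    (solve 1 (λ x → con 0ℚ :+ :combination (+ 36 / 1) (+ 12 / 1) x
        := con (+ 3 / 2) :- con (+ 24 / 1) :* x) refl ε)

  -- The left side equals 1 - 9ε - 96ε². The coefficient 24 is large enough to absorb the added ε,
  -- which later serves as a strict gap.
  product-small : (+ 3 / 2 ℚ.- + 24 / 1 ℚ.* ε) ℚ.* gainBound ℚ.+ ε ℚ.≤ 1ℚ
  product-small = ≤-fromSlack (+ 9 / 1 ℚ.* ε ℚ.+ + 96 / 1 ℚ.* (ε ℚ.* ε))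
    (ℚ.+-mono-≤ (0≤p*q (+ 9 / 1) 0≤ε)
                (0≤p*q (+ 96 / 1) (0≤p*q ε {{ℚ.nonNegative 0≤ε}} 0≤ε)))
    (solve 1 (λ x → ((con (+ 3 / 2) :- con (+ 24 / 1) :* x) :* :bound x :+ x)
        :+ (con (+ 9 / 1) :* x :+ con (+ 96 / 1) :* (x :* x)) := con 1ℚ) refl ε)

  -- The two continuations and the gain of the algorithm on them.

  afterBC afterBCD afterBCE : Instance _
  afterBC  = itemB ∷ itemC ∷ []
  afterBCD = afterBC ∷ʳ itemD
  afterBCE = afterBC ∷ʳ itemE

  -- The common outcome of both continuations; `gain≥0` is what allows multiplying an inequality by
  -- the gain.
  record Trap (A : OnlineAlgorithm) : Set where
    field
      {length} : ℕ
      items    : Instance length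
      optimum  : Multiset length
      full     : ∀ i → seq (gain items optimum) i ≡ 1ℚ
      gain≥0   : ∀ i → 0ℚ ℚ.≤ seq (gain items (knapsack A items)) i
      gain≤    : ∀ i → seq (gain items (knapsack A items)) i ℚ.≤ gainBound

  -- At most `j` items fit, and each has size at most `M`.
  packed-bounds : ∀ {n m M} j (I : Instance n) S → PackedWithin m M I S →
    0ℚ ℚ.≤ m → m ℚ.≤ M → 1ℚ ℚ.+ ε ℚ.≤ suc j ×ℚ m → j ×ℚ M ℚ.≤ gainBound →
    IsSolution I S →
    ∀ i → (0ℚ ℚ.≤ seq (gain I S) i) × (seq (gain I S) i ℚ.≤ gainBound)
  packed-bounds j I S within 0≤m m≤M 1<m M≤ S≤1 i =
      ℚ.≤-trans (0≤n×p (sum S) 0≤m) (total-lower within i)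
    , ℚ.≤-trans (total-upper within i)
        (ℚ.≤-trans (×-monoˡ-≤ (ℚ.≤-trans 0≤m m≤M)
          (solution-count j I S within 0≤m 0<ε 1<m S≤1)) M≤)

  1-copy≤ : ∀ k (x : Item) i → 0ℚ ℚ.≤ seq (size x) i →
    1 ×ℚ seq (size x) i ℚ.≤ seq (suc k · size x) i
  1-copy≤ k x i 0≤x = subst (_ ℚ.≤_) (sym (seq-· (suc k) (size x) i))
    (×-monoˡ-≤ {n = suc k} 0≤x (ℕ.s≤s z≤n))

  notBoth : ∀ k l → ¬ IsSolution afterBC (suc k ∷ suc l ∷ [])
  notBoth k l S≤1 = S≤1 (fromℚ-< 1ℚ (total afterBC (suc k ∷ suc l ∷ [])) 0<ε λ i →
    ℚ.≤-trans b+c>1 (ℚ.+-mono-≤ (1-copy≤ k itemB i (ℚ.≤-trans 0≤d d≤b))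
      (ℚ.+-monoˡ-≤ 0ℚ (1-copy≤ l itemC i (ℚ.≤-trans 0≤e e≤c)))))

  bounds-BCD : ∀ {k} S → Pointwise ℕ._≤_ (init S) (k ∷ 0 ∷ []) → IsSolution afterBCD S →
    ∀ i → (0ℚ ℚ.≤ seq (gain afterBCD S) i) × (seq (gain afterBCD S) i ℚ.≤ gainBound)
  -- `z≤n` forces zero copies of c: absent before d arrives, it cannot be packed again. What remains
  -- has size d or b.
  bounds-BCD S@(_ ∷ _ ∷ _ ∷ []) (_ ∷ z≤n ∷ []) = packed-bounds 1 afterBCD S
    (inj₂ (λ _ → d≤b , ℚ.≤-refl) ∷ inj₁ refl ∷ inj₂ (λ _ → ℚ.≤-refl , d≤b) ∷ [])
    0≤d d≤b 2d>1 1×b≤gainBound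

  bounds-BCE : ∀ {l} S → Pointwise ℕ._≤_ (init S) (0 ∷ l ∷ []) → IsSolution afterBCE S →
    ∀ i → (0ℚ ℚ.≤ seq (gain afterBCE S) i) × (seq (gain afterBCE S) i ℚ.≤ gainBound)
  -- In the same way b stays absent, which leaves sizes e and c.
  bounds-BCE S@(_ ∷ _ ∷ _ ∷ []) (z≤n ∷ _ ∷ []) = packed-bounds 2 afterBCE S
    (inj₁ refl ∷ inj₂ (λ _ → e≤c , ℚ.≤-refl) ∷ inj₂ (λ _ → ℚ.≤-refl , e≤c) ∷ [])
    0≤e e≤c 3e>1 2×c≤gainBound

  trap : ∀ A → Trap A
  trap A = respond (knapsack A afterBC) refl
    where
    -- The equation carries the counts found by case analysis into the bound given by `step`.
    respond : ∀ S → knapsack A afterBC ≡ S → Trap A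
    respond (zero ∷ l ∷ []) eq = record
      { items   = afterBCE
      ; optimum = 1 ∷ 0 ∷ 1 ∷ []
      ; full    = λ _ → solve 1 (λ x →
          (:b x :+ con 0ℚ) :+ (con 0ℚ :+ ((:e x :+ con 0ℚ) :+ con 0ℚ)) := con 1ℚ) refl ε
      ; gain≥0  = λ i → proj₁ (bounds i)
      ; gain≤   = λ i → proj₂ (bounds i)
      }
      where
      bounds = bounds-BCE (knapsack A afterBCE)
        (subst (Pointwise ℕ._≤_ _) eq (step A afterBC itemE)) (valid A afterBCE)
    respond (suc k ∷ zero ∷ []) eq = record
      { items   = afterBCD
      ; optimum = 0 ∷ 1 ∷ 1 ∷ []
      ; full    = λ _ → solve 1 (λ x →
          con 0ℚ :+ ((:c x :+ con 0ℚ) :+ ((:d x :+ con 0ℚ) :+ con 0ℚ)) := con 1ℚ) refl ε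
      ; gain≥0  = λ i → proj₁ (bounds i)
      ; gain≤   = λ i → proj₂ (bounds i)
      }
      where
      bounds = bounds-BCD (knapsack A afterBCD)
        (subst (Pointwise ℕ._≤_ _) eq (step A afterBC itemD)) (valid A afterBCD)
    respond (suc k ∷ suc l ∷ []) eq =
      contradiction (subst (IsSolution afterBC) eq (valid A afterBC)) (notBoth k l)

  not-competitive : ∀ A ρ N →
    (∀ i → N ℕ.≤ i → seq ρ i ℚ.+ + 24 / 1 ℚ.* ε ℚ.≤ + 3 / 2) → ¬ IsCompetitive A ρ
  not-competitive A ρ N ρ< competitive =
    -- `≤` is a negated `<`, so the gap ε from index `N` on refutes competitiveness.
    competitive items optimum (optimal-full full) (ε , 0<ε , N , gap)
    where
    open Trap (trap A)
    open ℚ.≤-Reasoning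
    r : ℚ
    r = + 3 / 2 ℚ.- + 24 / 1 ℚ.* ε
    ρ≤r : ∀ i → N ℕ.≤ i → seq ρ i ℚ.≤ r
    ρ≤r i N≤i = subst (ℚ._≤ r)
      (solve 2 (λ p q → (p :+ q) :- q := p) refl (seq ρ i) (+ 24 / 1 ℚ.* ε))
      (ℚ.+-monoˡ-≤ (ℚ.- (+ 24 / 1 ℚ.* ε)) (ρ< i N≤i))
    gap : ∀ i → N ℕ.≤ i →
      seq ρ i ℚ.* seq (gain items (knapsack A items)) i ℚ.+ ε ℚ.≤ seq (gain items optimum) i
    gap i N≤i = begin
      -- The order matters: the sign of `seq ρ i` is unknown, so it is replaced first, using g ≥ 0,
      -- and then g is raised using r ≥ 0.
      seq ρ i ℚ.* g ℚ.+ ε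
        ≤⟨ ℚ.+-monoˡ-≤ ε (ℚ.*-monoʳ-≤-nonNeg g {{ℚ.nonNegative (gain≥0 i)}} (ρ≤r i N≤i)) ⟩
      r ℚ.* g ℚ.+ ε
        ≤⟨ ℚ.+-monoˡ-≤ ε (ℚ.*-monoˡ-≤-nonNeg r {{ℚ.nonNegative 0≤3/2-24ε}} (gain≤ i)) ⟩
      r ℚ.* gainBound ℚ.+ ε
        ≤⟨ product-small ⟩
      1ℚ
        ≡⟨ full i ⟨
      seq (gain items optimum) i ∎
      where
      g = seq (gain items (knapsack A items)) i

competitive⇒3/2≤ : ∀ A ρ → IsCompetitive A ρ → fromℚ (+ 3 / 2) ≤ ρ
competitive⇒3/2≤ A ρ competitive (η , 0<η , N , ρ+η≤3/2) =
  Adversary.not-competitive ε 0<ε ε≤1/24 A ρ N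
    (λ i N≤i → ℚ.≤-trans (ℚ.+-monoʳ-≤ (seq ρ i) 24ε≤η) (ρ+η≤3/2 i N≤i)) competitive
  where
  ε : ℚ
  -- The minimum with 1 keeps ε ≤ 1/24, and the factor 1/24 gives 24ε ≤ η, the gap between ρ and
  -- 3/2.
  ε = + 1 / 24 ℚ.* (η ℚ.⊓ 1ℚ)
  0<ε : 0ℚ ℚ.< ε
  0<ε = ℚ.*-monoʳ-<-pos (+ 1 / 24) (0<⊓ (ℚ.⊓-sel η 1ℚ))
    where
    0<⊓ : ∀ {p} → (p ≡ η) ⊎ (p ≡ 1ℚ) → 0ℚ ℚ.< p
    0<⊓ (inj₁ refl) = 0<η
    0<⊓ (inj₂ refl) = ℚ.positive⁻¹ 1ℚ
  ε≤1/24 : ε ℚ.≤ + 1 / 24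
  ε≤1/24 = ℚ.*-monoˡ-≤-nonNeg (+ 1 / 24) (ℚ.p⊓q≤q η 1ℚ)
  24ε≤η : + 24 / 1 ℚ.* ε ℚ.≤ η
  24ε≤η = subst (ℚ._≤ η)
    (solve 1 (λ x → x := con (+ 24 / 1) :* (con (+ 1 / 24) :* x)) refl (η ℚ.⊓ 1ℚ))
    (ℚ.p⊓q≤p η 1ℚ)

lemma3 : (A : OnlineAlgorithm) (ρ : ℝ ⁺) → IsCompetitiveRatio A ρ →
    ¬ (ρ <⁺ [ fromℚ (+ 3 / 2) ])
lemma3 A ρ ratio ρ<3/2
  -- 3/2 bounds all competitive constants from below, hence also their infimum ρ; ρ is finite
  -- because it lies below 3/2.
  with ρ<3/2 | IsInfimum.greatest ratio [ fromℚ (+ 3 / 2) ]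
                 (λ c (_ , competitive) → ≤⁺.[ competitive⇒3/2≤ A c competitive ])
... | <⁺.[ r<3/2 ] | ≤⁺.[ 3/2≤r ] = 3/2≤r r<3/2
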